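{- For every positive integer $k$, the limit $\lim_{n\to\infty}\frac{\bar{\mathcal{M}}(k,n)}{n}$ exists and \[ \lim_{n\to\infty}\frac{\bar{\mathcal{M}}(k,n)}{n}=\lim_{n\to\infty}\frac{\mathcal{M}(k,n)}{n}=c_k. \]
   Context: For $n\ge2$ and $1\le k\le n-1$, let $s_k=(k\ k{+}1)\in S_n$ and $w_0=n\,(n-1)\cdots 2\,1$ the longest permutation of $S_n$. $\mathcal{M}(k,n)$ denotes the maximum number of occurrences of $s_k$ in a reduced word of $w_0$, and $\bar{\mathcal{M}}(k,n)$ denotes the maximum, over reduced words of $w_0$, of the total number of occurrences of $s_k$ and $s_{n-k}$. $c_k=\lim_{n\to\infty}\mathcal{M}(k,n)/n$. -}

module Defs where

open import Data.Nat using (ℕ; zero; suc; _∸_; _*_; _≤_; _<_)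
open import Data.Nat.Properties using (_≟_)
open import Data.Integer using (+_)
open import Data.Rational using (ℚ; 0ℚ; _/_; _-_; ∣_∣) renaming (_<_ to _<ℚ_)
open import Data.List using (List; []; _∷_; foldl; length; filter; map; upTo; reverse)
open import Data.List.Relation.Unary.All using (All)
open import Data.Product using (_×_; Σ; ∃; ∃-syntax)
open import Data.Sum using (_⊎_)
open import Relation.Binary.PropositionalEquality using (_≡_)
open import Relation.Nullary.Decidable using (_⊎-dec_)

-- Permutations of {1,…,n} in one-line notation, as lists of naturals.
-- swap0 j p swaps the entries at 0-based positions j and j+1.
swap0 : ℕ → List ℕ → List ℕ
swap0 zero    (x ∷ y ∷ xs) = y ∷ x ∷ xs
swap0 zero    xs           = xs
swap0 (suc j) (x ∷ xs)     = x ∷ swap0 j xs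
swap0 (suc j) []           = []

idPerm : ℕ → List ℕ
idPerm n = map suc (upTo n)

w0 : ℕ → List ℕ
w0 n = reverse (idPerm n)

-- A word is a list of generator indices i (standing for s_i = (i i+1)).
-- evalWord n w = s_{i1} s_{i2} … s_{il} in one-line notation
-- (right multiplication by s_i swaps positions i and i+1).
evalWord : ℕ → List ℕ → List ℕ
evalWord n w = foldl (λ p i → swap0 (i ∸ 1) p) (idPerm n) w

IsWord : ℕ → List ℕ → Set
IsWord n w = All (λ i → (1 ≤ i) × (i < n)) w

IsReducedWordOfW0 : ℕ → List ℕ → Set
IsReducedWordOfW0 n w =
  IsWord n w × (evalWord n w ≡ w0 n) ×
  (∀ v → IsWord n v → evalWord n v ≡ w0 n → length w ≤ length v)

occ : ℕ → List ℕ → ℕ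
occ k w = length (filter (λ i → i ≟ k) w)

occBar : ℕ → ℕ → List ℕ → ℕ
occBar k n w = length (filter (λ i → (i ≟ k) ⊎-dec (i ≟ n ∸ k)) w)

IsMaxOverReduced : ℕ → (List ℕ → ℕ) → ℕ → Set
IsMaxOverReduced n f m =
  (∃[ w ] (IsReducedWordOfW0 n w × f w ≡ m)) ×
  (∀ w → IsReducedWordOfW0 n w → f w ≤ m)

-- a / d as a rational (d = 0 gives 0, never used for d > 0 terms that matter)
frac : ℕ → ℕ → ℚ
frac a zero    = 0ℚ
frac a (suc d) = (+ a) / suc d

-- rational Cauchy sequence (= convergent in ℝ)
CauchyQ : (ℕ → ℚ) → Set
CauchyQ f = ∀ (ε : ℚ) → 0ℚ <ℚ ε →
  ∃[ N ] (∀ m n → N ≤ m → N ≤ n → ∣ f m - f n ∣ <ℚ ε)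

DiffToZero : (ℕ → ℚ) → (ℕ → ℚ) → Set
DiffToZero f g = ∀ (ε : ℚ) → 0ℚ <ℚ ε →
  ∃[ N ] (∀ n → N ≤ n → ∣ f n - g n ∣ <ℚ ε)

{-# OPTIONS --safe #-}

-- Reduced words of w₀ are the words all of whose steps create an inversion.
-- Call x small-clear in a state if fewer than k smaller values precede it, and
-- large-clear if fewer than k larger values do. Smaller values in front of x
-- only disappear and larger ones only accumulate, so every value that has been
-- among the first k entries up to some time is small-clear at that time, and
-- every value that will be among them later is large-clear. At most 2k values
-- are both, since they stand among the first 2k entries. Deleting the values that
-- are not small-clear (not large-clear) from a reduced word keeps the occurrences
-- of s_k before (after) that time at level k; cutting when exactly m values are
-- small-clear gives the second half of
--   M(m) + M(n) ≤ M(m+n) ≤ M(m) + M(n+2k),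
-- the first half being a concatenation of words.
-- These bounds yield |M(n)/n − M(m)/m| ≤ C (1/m + 1/n) with an explicit C, so the
-- convergence is effective. For M̄, a value visits both the first k and the last
-- k positions only if it is within 2k of 1 or of n; deleting the other values and
-- reversing the part at the bottom gives M(n) ≤ M̄(n) ≤ M(n+4k).
module Submission where

open import Defs
open import Data.Nat
open import Data.Nat.Properties
open import Data.List using (List; []; _∷_; _++_; _∷ʳ_; map; filter; foldl; length; reverse; take; drop; upTo)
open import Data.List.Properties
open import Data.List.Membership.Propositional using (_∈_; find; lose)
open import Data.List.Membership.DecPropositional _≟_ using (_∈?_)
open import Data.List.Relation.Unary.Any using (Any; here; there; any?)
open import Data.List.Relation.Unary.All as All using (All; []; _∷_)
import Data.List.Relation.Unary.All.Properties as All
open import Data.List.Membership.Propositional.Properties using (∈-upTo⁻)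
open import Data.List.Relation.Unary.AllPairs using ([]; _∷_)
open import Data.List.Relation.Unary.Unique.Propositional using (Unique)
import Data.List.Relation.Unary.Unique.Propositional.Properties as Unique
open import Data.Nat.Coprimality using (Coprime)
open import Data.Nat.Tactic.RingSolver using (solve-∀)
import Data.Integer as ℤ
import Data.Integer.Properties as ℤ
open import Data.Rational as ℚ using (ℚ; mkℚ; 0ℚ; toℚᵘ)
import Data.Rational.Properties as ℚ
open import Data.Rational.Unnormalised using (mkℚᵘ; *<*)
import Data.Rational.Unnormalised.Properties as ℚᵘ
import Algebra.Properties.Group as Group
open import Algebra.Properties.CommutativeSemigroup +-commutativeSemigroup using (x∙yz≈y∙xz)
open import Data.Product using (_×_; _,_; proj₁; proj₂; ∃-syntax)
open import Data.Sum using (_⊎_; inj₁; inj₂)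
open import Function using (_∘_; id)
open import Relation.Nullary using (¬_; yes; no; contradiction)
open import Relation.Nullary.Decidable using (¬?; _⊎-dec_)
open import Relation.Unary using (Decidable)
open import Relation.Binary.Definitions using (tri<; tri≈; tri>)
open import Relation.Binary.PropositionalEquality

private variable
  i j k m n x y z v : ℕ
  p q r s w w′ : List ℕ
  P Q R : ℕ → Set

-- Positions are 0-based, letters 1-based: a step at position i is the letter suc i.
data Step : ℕ → List ℕ → List ℕ → Set where
  here  : x < y → Step 0 (x ∷ y ∷ s) (y ∷ x ∷ s)
  there : Step i p q → Step (suc i) (x ∷ p) (x ∷ q)

-- Every letter must create an inversion, so reducedness is carried by the type and survives gluing,
-- cutting and restriction.
data Run : List ℕ → List ℕ → List ℕ → Set where
  []  : Run [] p p
  _∷_ : Step i p q → Run w q r → Run (suc i ∷ w) p r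

Sorting : ℕ → List ℕ → Set
Sorting n w = Run w (idPerm n) (w0 n)

occ-accept : ∀ k w → i ≡ k → occ k (i ∷ w) ≡ suc (occ k w)
occ-accept k w i≡k = cong length (filter-accept (_≟ k) i≡k)

occ-reject : ∀ k w → i ≢ k → occ k (i ∷ w) ≡ occ k w
occ-reject k w i≢k = cong length (filter-reject (_≟ k) i≢k)

occ-++ : ∀ k u v → occ k (u ++ v) ≡ occ k u + occ k v
occ-++ k u v = trans (cong length (filter-++ (_≟ k) u v)) (length-++ (filter (_≟ k) u))

_▷_ : ∀ {u} → Run u p q → Run w q r → Run (u ++ w) p r
[]      ▷ b = b
(s ∷ a) ▷ b = s ∷ (a ▷ b)

step-length : Step i p q → length q ≡ length p
step-length (here _)  = refl
step-length (there s) = cong suc (step-length s)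

step-bound : Step i p q → suc i < length p
step-bound (here _)  = s≤s (s≤s z≤n)
step-bound (there s) = s≤s (step-bound s)

step-All : Step i p q → All P p → All P q
step-All (here _)  (a ∷ b ∷ c) = b ∷ a ∷ c
step-All (there s) (a ∷ b)     = a ∷ step-All s b

step-unique : Step i p q → Unique p → Unique q
step-unique (here _) ((a ∷ b) ∷ c ∷ d) = ((λ e → a (sym e)) ∷ c) ∷ b ∷ d
step-unique (there s) (a ∷ b) = step-All s a ∷ step-unique s b

step-swap : Step i p q → swap0 i p ≡ q
step-swap (here _)        = refl
step-swap (there {x = x} s) = cong (x ∷_) (step-swap s)

idPerm-suc : ∀ n → idPerm (suc n) ≡ idPerm n ∷ʳ suc n
idPerm-suc n = trans (cong (map suc) (sym (upTo-∷ʳ n))) (map-++ suc (upTo n) _)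

w0-suc : ∀ n → w0 (suc n) ≡ suc n ∷ w0 n
w0-suc n = trans (cong reverse (idPerm-suc n)) (reverse-++ (idPerm n) _)

length-idPerm : ∀ n → length (idPerm n) ≡ n
length-idPerm n = trans (length-map suc (upTo n)) (length-upTo n)

-- Reduced words of the longest permutation

smaller : ℕ → List ℕ → ℕ
smaller x [] = 0
smaller x (y ∷ p) with y <? x
... | yes _ = suc (smaller x p)
... | no  _ = smaller x p

inv : List ℕ → ℕ
inv []      = 0
inv (x ∷ p) = smaller x p + inv p

act : List ℕ → List ℕ → List ℕ
act w p = foldl (λ p i → swap0 (i ∸ 1) p) p w

smaller-swap : ∀ z i p → smaller z (swap0 i p) ≡ smaller z p
smaller-swap z zero [] = refl
smaller-swap z zero (x ∷ []) = refl
smaller-swap z zero (x ∷ y ∷ p) with x <? z in ex | y <? z in ey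
... | yes _ | yes _ rewrite ex | ey = refl
... | yes _ | no  _ rewrite ex | ey = refl
... | no  _ | yes _ rewrite ex | ey = refl
... | no  _ | no  _ rewrite ex | ey = refl
smaller-swap z (suc i) [] = refl
smaller-swap z (suc i) (x ∷ p) with x <? z
... | yes _ = cong suc (smaller-swap z i p)
... | no  _ = smaller-swap z i p

smaller-accept : ∀ p → y < x → smaller x (y ∷ p) ≡ suc (smaller x p)
smaller-accept {y} {x} p y<x with y <? x
... | yes _   = refl
... | no  y≮x = contradiction y<x y≮x

smaller-reject : ∀ p → ¬ y < x → smaller x (y ∷ p) ≡ smaller x p
smaller-reject {y} {x} p y≮x with y <? x
... | yes y<x = contradiction y<x y≮x
... | no  _   = refl

smaller-grows : ∀ x y p → smaller x p ≤ smaller x (y ∷ p)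
smaller-grows x y p with y <? x
... | yes _ = n≤1+n _
... | no  _ = ≤-refl

-- `smaller` ignores the order of the list, so the only new inversion is the swapped pair itself.
step-inv : Step i p q → inv q ≡ suc (inv p)
step-inv (here {x} {y} {s} x<y) = begin
  smaller y (x ∷ s) + (smaller x s + inv s)
    ≡⟨ cong (_+ _) (smaller-accept s x<y) ⟩
  suc (smaller y s + (smaller x s + inv s))
    ≡⟨ cong suc (x∙yz≈y∙xz (smaller y s) (smaller x s) (inv s)) ⟩
  suc (smaller x s + (smaller y s + inv s))
    ≡⟨ cong (λ a → suc (a + _)) (smaller-reject s (<-asym x<y)) ⟨
  suc (smaller x (y ∷ s) + (smaller y s + inv s)) ∎
  where open ≡-Reasoning
step-inv (there {i} {p} {x = x} s) with refl ← step-swap s =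
  trans (cong₂ _+_ (smaller-swap x i p) (step-inv s)) (+-suc _ _)

-- A swap that is not a `Step` meets a pair that does not ascend, or runs off the end and does
-- nothing.
swap-cases : ∀ i p → Step i p (swap0 i p) ⊎ inv (swap0 i p) ≤ inv p
swap-cases zero []       = inj₂ z≤n
swap-cases zero (x ∷ []) = inj₂ ≤-refl
swap-cases zero (x ∷ y ∷ p) with x <? y
... | yes x<y = inj₁ (here x<y)
... | no  x≮y = inj₂ (begin
  smaller y p + (smaller x p + inv p)
    ≡⟨ x∙yz≈y∙xz (smaller y p) (smaller x p) (inv p) ⟩
  smaller x p + (smaller y p + inv p)
    ≤⟨ +-monoˡ-≤ _ (smaller-grows x y p) ⟩
  smaller x (y ∷ p) + (smaller y p + inv p) ∎)
  where open ≤-Reasoning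
swap-cases (suc i) [] = inj₂ z≤n
swap-cases (suc i) (x ∷ p) with swap-cases i p
... | inj₁ s  = inj₁ (there s)
... | inj₂ le = inj₂ (+-mono-≤ (≤-reflexive (smaller-swap x i p)) le)

run-act : Run w p r → act w p ≡ r
run-act []      = refl
run-act (_∷_ {w = w} s a) = trans (cong (act w) (step-swap s)) (run-act a)

run-inv : Run w p r → inv r ≡ length w + inv p
run-inv []      = refl
run-inv (_∷_ {w = w} s a) =
  trans (run-inv a) (trans (cong (length w +_) (step-inv s)) (+-suc _ _))

act-inv : ∀ w p → inv (act w p) ≤ length w + inv p
act-inv [] p = ≤-refl
act-inv (i ∷ w) p = begin
  inv (act w (swap0 (i ∸ 1) p))      ≤⟨ act-inv w _ ⟩
  length w + inv (swap0 (i ∸ 1) p)   ≤⟨ +-monoʳ-≤ (length w) (bound (swap-cases (i ∸ 1) p)) ⟩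
  length w + suc (inv p)             ≡⟨ +-suc _ _ ⟩
  suc (length w + inv p)             ∎
  where
  open ≤-Reasoning
  bound : Step (i ∸ 1) p q ⊎ inv q ≤ inv p → inv q ≤ suc (inv p)
  bound (inj₁ s)  = ≤-reflexive (step-inv s)
  bound (inj₂ le) = ≤-trans le (n≤1+n _)

-- A letter raises `inv` by at most one (`act-inv`), so a word attaining the largest possible gain
-- cannot waste a letter.
act-run : All (1 ≤_) w → length w + inv p ≤ inv (act w p) → Run w p (act w p)
act-run [] _ = []
act-run {w = suc i ∷ w} {p} (_ ∷ pos) long with swap-cases i p
... | inj₁ s = s ∷ act-run pos
      (≤-trans (≤-reflexive (trans (cong (length w +_) (step-inv s)) (+-suc (length w) _))) long)
... | inj₂ le = contradiction
      (≤-trans long (≤-trans (act-inv w _) (+-monoʳ-≤ (length w) le))) 1+n≰n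

run-letters : Run w p r → IsWord (length p) w
run-letters []      = []
run-letters (s ∷ a) = (s≤s z≤n , step-bound s) ∷ subst (λ l → IsWord l _) (step-length s) (run-letters a)

-- A run is exactly as long as its gain in `inv`, and no word makes that gain with fewer letters.
sorting⇒reduced : Sorting n w → IsReducedWordOfW0 n w
sorting⇒reduced {n} {w} a =
  subst (λ l → IsWord l w) (length-idPerm n) (run-letters a) , run-act a , minimal
  where
  minimal : ∀ v → IsWord n v → evalWord n v ≡ w0 n → length w ≤ length v
  minimal v _ eq = +-cancelʳ-≤ (inv (idPerm n)) _ _ (begin
    length w + inv (idPerm n) ≡⟨ run-inv a ⟨
    inv (w0 n)                ≡⟨ cong inv eq ⟨
    inv (evalWord n v)        ≤⟨ act-inv v (idPerm n) ⟩
    length v + inv (idPerm n) ∎)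
    where open ≤-Reasoning

-- Concatenation of sorting words

step-++ : ∀ s → Step i p q → Step i (p ++ s) (q ++ s)
step-++ s (here x<y) = here x<y
step-++ s (there a)  = there (step-++ s a)

run-++ : ∀ s → Run w p q → Run w (p ++ s) (q ++ s)
run-++ s []      = []
run-++ s (a ∷ b) = step-++ s a ∷ run-++ s b

run-there : ∀ x → Run w p q → Run (map suc w) (x ∷ p) (x ∷ q)
run-there x []      = []
run-there x (a ∷ b) = there a ∷ run-there x b

-- Monotonicity is asked only on the values present: `card`, the map used for standardization, is
-- strict on the members of `P` but in general not on all naturals.
step-map : (g : ℕ → ℕ) → (∀ {x y} → P x → P y → x < y → g x < g y) →
           All P p → Step i p q → Step i (map g p) (map g q)
step-map g mono (px ∷ py ∷ _) (here x<y) = here (mono px py x<y)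
step-map g mono (_ ∷ pp) (there s) = there (step-map g mono pp s)

run-map : (g : ℕ → ℕ) → (∀ {x y} → P x → P y → x < y → g x < g y) →
          All P p → Run w p q → Run w (map g p) (map g q)
run-map g mono pp []      = []
run-map g mono pp (s ∷ a) = step-map g mono pp s ∷ run-map g mono (step-All s pp) a

move-left : ∀ s → All (_< y) p → ∃[ w ] Run w (p ++ y ∷ s) (y ∷ p ++ s)
move-left s []        = [] , []
move-left s (x<y ∷ a) with _ , b ← move-left s a = _ , run-there _ b ▷ (here x<y ∷ [])

move-block : All (λ y → All (_< y) p) q → ∃[ w ] Run w (p ++ q) (q ++ p)
move-block {p} [] = [] , subst (λ l → Run [] l p) (sym (++-identityʳ p)) []
move-block {q = y ∷ q} (a ∷ as) with _ , b ← move-left q a | _ , c ← move-block as =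
  _ , b ▷ run-there y c

idPerm-+ : ∀ m n → idPerm (m + n) ≡ idPerm m ++ map (m +_) (idPerm n)
idPerm-+ m zero = trans (cong idPerm (+-identityʳ m)) (sym (++-identityʳ _))
idPerm-+ m (suc n) = begin
  idPerm (m + suc n)                                 ≡⟨ cong idPerm (+-suc m n) ⟩
  idPerm (suc (m + n))                               ≡⟨ idPerm-suc (m + n) ⟩
  idPerm (m + n) ∷ʳ suc (m + n)                      ≡⟨ cong₂ _∷ʳ_ (idPerm-+ m n) (sym (+-suc m n)) ⟩
  (idPerm m ++ map (m +_) (idPerm n)) ∷ʳ (m + suc n) ≡⟨ ++-assoc (idPerm m) _ _ ⟩
  idPerm m ++ map (m +_) (idPerm n) ∷ʳ (m + suc n)   ≡⟨ cong (idPerm m ++_) (map-++ (m +_) (idPerm n) _) ⟨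
  idPerm m ++ map (m +_) (idPerm n ∷ʳ suc n)         ≡⟨ cong (λ l → idPerm m ++ map (m +_) l) (idPerm-suc n) ⟨
  idPerm m ++ map (m +_) (idPerm (suc n))            ∎
  where open ≡-Reasoning

w0-+ : ∀ m n → w0 (m + n) ≡ map (m +_) (w0 n) ++ w0 m
w0-+ m zero = cong w0 (+-identityʳ m)
w0-+ m (suc n) = begin
  w0 (m + suc n)                      ≡⟨ cong w0 (+-suc m n) ⟩
  w0 (suc (m + n))                    ≡⟨ w0-suc (m + n) ⟩
  suc (m + n) ∷ w0 (m + n)            ≡⟨ cong₂ _∷_ (sym (+-suc m n)) (w0-+ m n) ⟩
  map (m +_) (suc n ∷ w0 n) ++ w0 m   ≡⟨ cong (λ l → map (m +_) l ++ w0 m) (w0-suc n) ⟨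
  map (m +_) (w0 (suc n)) ++ w0 m     ∎
  where open ≡-Reasoning

idPerm-range : ∀ n → All (λ x → 1 ≤ x × x ≤ n) (idPerm n)
idPerm-range n = All.map⁺ (All.tabulate (λ x∈ → s≤s z≤n , ∈-upTo⁻ x∈))

w0-range : ∀ n → All (λ x → 1 ≤ x × x ≤ n) (w0 n)
w0-range zero = []
w0-range (suc n) rewrite w0-suc n =
  (s≤s z≤n , ≤-refl) ∷ All.map (λ (a , b) → a , m≤n⇒m≤1+n b) (w0-range n)

-- Sort the `m` small values by `u`, then move the `n` large values in front of them as a block. The
-- large values now fill the first `n` positions, so `v` applies with its letters unshifted.
join : ∀ {u v} → Sorting m u → Sorting n v →
       ∃[ w ] Sorting (m + n) w × (∀ k → occ k u + occ k v ≤ occ k w)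
join {m} {n} {u} {v} a b = _ ,
  subst₂ (Run _) (sym (idPerm-+ m n)) (sym (w0-+ m n))
    (run-++ _ a ▷ (proj₂ c ▷ run-++ (w0 m) shifted)) , count
  where
  c : ∃[ w ] Run w (w0 m ++ map (m +_) (idPerm n)) (map (m +_) (idPerm n) ++ w0 m)
  c = move-block (All.map⁺ (All.map
        (λ (1≤y , _) → All.map (λ (_ , x≤m) → ≤-trans (s≤s x≤m) (m<m+n m 1≤y)) (w0-range m))
        (idPerm-range n)))
  shifted = run-map (m +_) (λ _ _ → +-monoʳ-< m) (idPerm-range n) b
  count : ∀ k → occ k u + occ k v ≤ occ k (u ++ proj₁ c ++ v)
  count k = begin
    occ k u + occ k v                       ≤⟨ +-monoʳ-≤ (occ k u) (m≤n+m _ _) ⟩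
    occ k u + (occ k (proj₁ c) + occ k v)   ≡⟨ cong (occ k u +_) (occ-++ k (proj₁ c) v) ⟨
    occ k u + occ k (proj₁ c ++ v)          ≡⟨ occ-++ k u _ ⟨
    occ k (u ++ proj₁ c ++ v)               ∎
    where open ≤-Reasoning

sorting-exists : ∀ n → ∃[ w ] Sorting n w
sorting-exists zero    = [] , []
sorting-exists (suc n) with w , a , _ ← join {1} {u = []} [] (proj₂ (sorting-exists n)) = w , a

-- Makes the maximum of `occ k` monotone in the size, so words on fewer values than a given bound
-- may be compared with the maximum at that bound.
extend : m ≤ n → Sorting m w → ∃[ w′ ] Sorting n w′ × (∀ k → occ k w ≤ occ k w′)
extend {m} {n} {w} m≤n a with w′ , b , le ← join a (proj₂ (sorting-exists (n ∸ m))) =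
  w′ , subst (λ l → Sorting l w′) (m+[n∸m]≡n m≤n) b , λ k → ≤-trans (m≤m+n _ _) (le k)

-- Some sorting word exists and its length is the gain in `inv`; a shortest word is no longer, so
-- `act-run` applies to it.
reduced⇒sorting : IsReducedWordOfW0 n w → Sorting n w
reduced⇒sorting {n} {w} (word , eq , minimal) with w′ , a ← sorting-exists n =
  subst (Run w (idPerm n)) eq (act-run (All.map proj₁ word) (begin
    length w + inv (idPerm n)  ≤⟨ +-monoˡ-≤ _ (minimal w′ (proj₁ (sorting⇒reduced a)) (run-act a)) ⟩
    length w′ + inv (idPerm n) ≡⟨ run-inv a ⟨
    inv (w0 n)                 ≡⟨ cong inv eq ⟨
    inv (evalWord n w)         ∎))
  where open ≤-Reasoning

-- Restriction of a run to a set of values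

states : Run w p r → List (List ℕ)
states {p = p} []      = p ∷ []
states {p = p} (_ ∷ a) = p ∷ states a

states-invariant : ∀ {F : List ℕ → Set} → (∀ {i p q} → Step i p q → F p → F q) →
                   (a : Run w p r) → F p → All F (states a)
states-invariant pres []      f = f ∷ []
states-invariant pres (s ∷ a) f = f ∷ states-invariant pres a (pres s f)

first-state : (a : Run w p r) → p ∈ states a
first-state []      = here refl
first-state (_ ∷ _) = here refl

-- Since `n ∸ k` is a successor, `k < n`, and the truncated subtraction is a genuine reflection.
complement : ∀ n k → suc i ≡ n ∸ k → n ∸ suc i ≡ k
complement n k eq = trans (cong (n ∸_) eq)
  (m∸[m∸n]≡n (<⇒≤ (m∸n≢0⇒n<m λ e → 1+n≢0 (trans eq e))))

module _ {P : ℕ → Set} (P? : Decidable P) where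

  -- The step vanishes if one of the swapped values is deleted; otherwise it survives, shifted by
  -- the deletions in front of it.
  restrict-step : Step i p q → filter P? p ≡ filter P? q ⊎ ∃[ j ] Step j (filter P? p) (filter P? q)
  restrict-step (here {x} {y} x<y) with P? x in ex | P? y in ey
  ... | yes _ | yes _ rewrite ex | ey = inj₂ (0 , here x<y)
  ... | yes _ | no _ rewrite ex | ey = inj₁ refl
  ... | no _ | yes _ rewrite ex | ey = inj₁ refl
  ... | no _ | no _ rewrite ex | ey = inj₁ refl
  restrict-step (there {x = x} s) with P? x | restrict-step s
  ... | no  _ | t             = t
  ... | yes _ | inj₁ eq       = inj₁ (cong (x ∷_) eq)
  ... | yes _ | inj₂ (j , t)  = inj₂ (suc j , there t)

  restrict-length : Step i p q → length (filter P? q) ≡ length (filter P? p)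
  restrict-length s with restrict-step s
  ... | inj₁ eq      = cong length (sym eq)
  ... | inj₂ (_ , t) = step-length t

  -- Nothing in front of the swap is deleted, so the position stays. The entry at position `i` is
  -- one swapped value before the step and the other one after it, hence the two hypotheses.
  restrict-step-top : All P (take (suc i) p) → All P (take (suc i) q) → Step i p q →
                      Step i (filter P? p) (filter P? q)
  restrict-step-top (px ∷ _) (py ∷ _) (here {x} {y} {s} x<y)
    rewrite filter-accept P? {xs = y ∷ s} px | filter-accept P? {xs = x ∷ s} py
          | filter-accept P? {xs = s} px | filter-accept P? {xs = s} py = here x<y
  restrict-step-top (px ∷ a) (_ ∷ b) (there {p = p} {q = q} s)
    rewrite filter-accept P? {xs = p} px | filter-accept P? {xs = q} px =
      there (restrict-step-top a b s)

  -- Mirror image of `restrict-step-top`: nothing behind the swap is deleted, so its distance to the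
  -- end is preserved.
  restrict-step-bottom : All P (drop (suc i) p) → All P (drop (suc i) q) → Step i p q →
    ∃[ j ] Step j (filter P? p) (filter P? q) ×
           length p ∸ suc i ≡ length (filter P? p) ∸ suc j
  restrict-step-bottom (py ∷ ps) (px ∷ _) (here {x} {y} {s} x<y)
    rewrite filter-accept P? {xs = y ∷ s} px | filter-accept P? {xs = x ∷ s} py
          | filter-accept P? {xs = s} px | filter-accept P? {xs = s} py
          | filter-all P? ps = 0 , here x<y , refl
  restrict-step-bottom a b (there {x = x} s) with P? x | restrict-step-bottom a b s
  ... | no  _ | t            = t
  ... | yes _ | j , t , eq   = suc j , there t , eq

  -- Letters other than `k` may vanish or move, possibly to `m`; this only adds occurrences, hence
  -- the inequality.
  restrict-run : {F : List ℕ → Set} →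
    (∀ {i p q} → F p → F q → Step i p q → suc i ≡ k →
       ∃[ j ] Step j (filter P? p) (filter P? q) × suc j ≡ m) →
    (a : Run w p r) → All F (states a) →
    ∃[ w′ ] Run w′ (filter P? p) (filter P? r) × occ k w ≤ occ m w′
  restrict-run keep [] _ = [] , [] , z≤n
  restrict-run {k} {m} keep (_∷_ {i} {w = w} s a) (f ∷ fs)
    with suc i ≟ k | restrict-run keep a fs
  ... | yes eq | w′ , b , le with j , t , eq′ ← keep f (All.lookup fs (first-state a)) s eq =
    _ , t ∷ b , (begin
      occ k (suc i ∷ w)   ≡⟨ occ-accept k w eq ⟩
      suc (occ k w)       ≤⟨ s≤s le ⟩
      suc (occ m w′)      ≡⟨ occ-accept m w′ eq′ ⟨
      occ m (suc j ∷ w′)  ∎)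
    where open ≤-Reasoning
  ... | no neq | w′ , b , le with restrict-step s
  ...   | inj₁ eq = w′ , subst (λ l → Run w′ l _) (sym eq) b ,
                    ≤-trans (≤-reflexive (occ-reject k w neq)) le
  ...   | inj₂ (j , t) = _ , t ∷ b , (begin
      occ k (suc i ∷ w)              ≡⟨ occ-reject k w neq ⟩
      occ k w                        ≤⟨ le ⟩
      occ m w′                       ≤⟨ m≤n+m _ _ ⟩
      occ m (suc j ∷ []) + occ m w′  ≡⟨ occ-++ m (suc j ∷ []) w′ ⟨
      occ m (suc j ∷ w′)             ∎)
    where open ≤-Reasoning

  restrict-top : ∀ k (a : Run w p r) → All (λ s → All P (take k s)) (states a) →
    ∃[ w′ ] Run w′ (filter P? p) (filter P? r) × occ k w ≤ occ k w′
  restrict-top k = restrict-run λ { f g s refl → _ , restrict-step-top f g s , refl }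

  restrict : (a : Run w p r) → ∃[ w′ ] Run w′ (filter P? p) (filter P? r)
  -- For `k = 0` the condition on the first `k` entries is vacuous.
  restrict a with w′ , b , _ ← restrict-top 0 a (All.universal (λ _ → []) _) = w′ , b

  restrict-bottom : ∀ k (a : Run w p r) →
    All (λ s → All P (drop (length p ∸ k) s)) (states a) →
    ∃[ w′ ] Run w′ (filter P? p) (filter P? r) ×
            occ (length p ∸ k) w ≤ occ (length (filter P? p) ∸ k) w′
  restrict-bottom {p = p₀} k a fs = restrict-run keep a (All.zip (fs , All.zip (lengths , lengths′)))
    where
    N = length p₀
    N′ = length (filter P? p₀)
    lengths : All (λ s → length s ≡ N) (states a)
    lengths = states-invariant (λ s eq → trans (step-length s) eq) a refl
    lengths′ : All (λ s → length (filter P? s) ≡ N′) (states a)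
    lengths′ = states-invariant (λ s eq → trans (restrict-length s) eq) a refl
    keep : ∀ {i p q} → All P (drop (N ∸ k) p) × length p ≡ N × length (filter P? p) ≡ N′ →
      All P (drop (N ∸ k) q) × length q ≡ N × length (filter P? q) ≡ N′ →
      Step i p q → suc i ≡ N ∸ k → ∃[ j ] Step j (filter P? p) (filter P? q) × suc j ≡ N′ ∸ k
    keep {i} {p} {q} (f , lp , lp′) (g , _) s eq
      with j , t , eq′ ← restrict-step-bottom
             (subst (λ l → All P (drop l p)) (sym eq) f) (subst (λ l → All P (drop l q)) (sym eq) g) s =
      j , t , (begin
        -- Both letters have the same distance to the end, and for the original one this distance is
        -- `k`.
        suc j                  ≡⟨ m∸[m∸n]≡n (<⇒≤ (subst (suc j <_) lp′ (step-bound t))) ⟨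
        N′ ∸ (N′ ∸ suc j)      ≡⟨ cong (λ l → N′ ∸ (l ∸ suc j)) lp′ ⟨
        N′ ∸ (length (filter P? p) ∸ suc j) ≡⟨ cong (N′ ∸_) eq′ ⟨
        N′ ∸ (length p ∸ suc i) ≡⟨ cong (λ l → N′ ∸ (l ∸ suc i)) lp ⟩
        N′ ∸ (N ∸ suc i)       ≡⟨ cong (N′ ∸_) (complement N k eq) ⟩
        N′ ∸ k                 ∎)
      where open ≡-Reasoning

-- Cardinality, and standardization of a restricted run

module _ {P : ℕ → Set} (P? : Decidable P) where

  -- Counts the members of `P` in `1,…,n`. At a member this is its rank, so `card` is itself the
  -- standardization map.
  card : ℕ → ℕ
  card zero    = 0
  card (suc n) with P? (suc n)
  ... | yes _ = suc (card n)
  ... | no  _ = card n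

  card-accept : P (suc n) → card (suc n) ≡ suc (card n)
  card-accept {n} pn with P? (suc n)
  ... | yes _ = refl
  ... | no ¬pn = contradiction pn ¬pn

  card-mono : m ≤ n → card m ≤ card n
  card-mono {n = zero} z≤n = z≤n
  card-mono {m} {suc n} le with m≤n⇒m<n∨m≡n le
  ... | inj₂ refl = ≤-refl
  ... | inj₁ (s≤s le′) with P? (suc n)
  ...   | yes _ = ≤-trans (card-mono le′) (n≤1+n _)
  ...   | no  _ = card-mono le′

  card-strict : P x → P y → x < y → card x < card y
  card-strict {y = suc y} _ py (s≤s x≤y) rewrite card-accept py = s≤s (card-mono x≤y)

  standardize-id : ∀ n → map card (filter P? (idPerm n)) ≡ idPerm (card n)
  standardize-id zero = refl
  standardize-id (suc n) = begin
    map card (filter P? (idPerm (suc n)))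
      ≡⟨ cong (map card ∘ filter P?) (idPerm-suc n) ⟩
    map card (filter P? (idPerm n ∷ʳ suc n))
      ≡⟨ cong (map card) (filter-++ P? (idPerm n) _) ⟩
    map card (filter P? (idPerm n) ++ filter P? (suc n ∷ []))
      ≡⟨ map-++ card (filter P? (idPerm n)) _ ⟩
    map card (filter P? (idPerm n)) ++ map card (filter P? (suc n ∷ []))
      ≡⟨ cong (_++ map card (filter P? (suc n ∷ []))) (standardize-id n) ⟩
    idPerm (card n) ++ map card (filter P? (suc n ∷ []))
      ≡⟨ final ⟩
    idPerm (card (suc n)) ∎
    where
    open ≡-Reasoning
    final : idPerm (card n) ++ map card (filter P? (suc n ∷ [])) ≡ idPerm (card (suc n))
    final with P? (suc n) in e
    ... | yes _ rewrite e = sym (idPerm-suc (card n))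
    ... | no  _ = ++-identityʳ _

  standardize-w0 : ∀ n → map card (filter P? (w0 n)) ≡ w0 (card n)
  standardize-w0 zero = refl
  standardize-w0 (suc n) rewrite w0-suc n with P? (suc n) in e
  ... | yes _ rewrite e = trans (cong (suc (card n) ∷_) (standardize-w0 n)) (sym (w0-suc (card n)))
  ... | no _ = standardize-w0 n

  card-length : ∀ n → length (filter P? (idPerm n)) ≡ card n
  card-length n = trans (sym (length-map card (filter P? (idPerm n))))
    (trans (cong length (standardize-id n)) (length-idPerm (card n)))

  standardize : ∀ n → Run w (filter P? (idPerm n)) (filter P? (w0 n)) → Sorting (card n) w
  standardize n a = subst₂ (Run _) (standardize-id n) (standardize-w0 n)
    (run-map card card-strict (All.all-filter P? (idPerm n)) a)

  card-upper : ∀ h → (∀ v → P v → v ≤ h) → ∀ n → card n ≤ h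
  card-upper h le zero = z≤n
  card-upper h le (suc n) with P? (suc n)
  ... | no  _  = card-upper h le n
  ... | yes pn = ≤-trans (s≤s (below n)) (le (suc n) pn)
    where
    below : ∀ n → card n ≤ n
    below zero    = z≤n
    below (suc n) with P? (suc n)
    ... | yes _ = s≤s (below n)
    ... | no  _ = ≤-trans (below n) (n≤1+n n)

  card-lower : ∀ l → (∀ v → P v → l < v) → ∀ n → card n ≤ n ∸ l
  card-lower l lt zero = z≤n
  card-lower l lt (suc n) with P? (suc n)
  ... | no  _  = ≤-trans (card-lower l lt n) (∸-monoˡ-≤ l (n≤1+n n))
  ... | yes pn = ≤-trans (s≤s (card-lower l lt n)) (≤-reflexive (sym (+-∸-assoc 1 (≤-pred (lt (suc n) pn)))))

module _ {P Q : ℕ → Set} (P? : Decidable P) (Q? : Decidable Q) where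

  card-⊎ : ∀ {R : ℕ → Set} (R? : Decidable R) → (∀ v → P v → Q v ⊎ R v) →
           ∀ n → card P? n ≤ card Q? n + card R? n
  card-⊎ R? imp zero = z≤n
  card-⊎ R? imp (suc n) with P? (suc n) | Q? (suc n) | R? (suc n)
  ... | no  _ | no  _ | no  _ = card-⊎ R? imp n
  ... | no  _ | no  _ | yes _ = ≤-trans (card-⊎ R? imp n) (+-monoʳ-≤ (card Q? n) (n≤1+n _))
  ... | no  _ | yes _ | no  _ = ≤-trans (card-⊎ R? imp n) (n≤1+n _)
  ... | no  _ | yes _ | yes _ = ≤-trans (card-⊎ R? imp n) (+-mono-≤ (n≤1+n _) (n≤1+n _))
  ... | yes _ | yes _ | no  _ = s≤s (card-⊎ R? imp n)
  ... | yes _ | no  _ | yes _ = ≤-trans (s≤s (card-⊎ R? imp n)) (≤-reflexive (sym (+-suc _ _)))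
  ... | yes _ | yes _ | yes _ = s≤s (≤-trans (card-⊎ R? imp n) (+-monoʳ-≤ (card Q? n) (n≤1+n _)))
  ... | yes p | no ¬q | no ¬r with imp _ p
  ...   | inj₁ q = contradiction q ¬q
  ...   | inj₂ r = contradiction r ¬r

  -- Inclusion-exclusion, with the union bounded by `n`.
  card-∩ : ∀ {R : ℕ → Set} (R? : Decidable R) → (∀ v → P v → Q v → R v) →
           ∀ n → card P? n + card Q? n ≤ n + card R? n
  card-∩ R? imp zero = z≤n
  card-∩ R? imp (suc n) with P? (suc n) | Q? (suc n) | R? (suc n)
  ... | no  _ | no  _ | no  _ = ≤-trans (card-∩ R? imp n) (n≤1+n _)
  ... | no  _ | no  _ | yes _ = ≤-trans (card-∩ R? imp n) (+-mono-≤ (n≤1+n n) (n≤1+n _))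
  ... | no  _ | yes _ | no  _ = ≤-trans (≤-reflexive (+-suc _ _)) (s≤s (card-∩ R? imp n))
  ... | no  _ | yes _ | yes _ = ≤-trans (≤-reflexive (+-suc _ _))
                                  (s≤s (≤-trans (card-∩ R? imp n) (+-monoʳ-≤ n (n≤1+n _))))
  ... | yes _ | no  _ | no  _ = s≤s (card-∩ R? imp n)
  ... | yes _ | no  _ | yes _ = s≤s (≤-trans (card-∩ R? imp n) (+-monoʳ-≤ n (n≤1+n _)))
  ... | yes _ | yes _ | yes _ = s≤s (≤-trans (≤-reflexive (+-suc _ _))
                                  (≤-trans (s≤s (card-∩ R? imp n)) (≤-reflexive (sym (+-suc n _)))))
  ... | yes p | yes q | no ¬r = contradiction (imp _ p q) ¬r

-- Entries to the left of a value

left< : ℕ → List ℕ → ℕ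
left< v [] = 0
left< v (x ∷ p) with <-cmp x v
... | tri< _ _ _ = suc (left< v p)
... | tri≈ _ _ _ = 0
... | tri> _ _ _ = left< v p

-- `left< v p + left> v p` is the 0-based position of the first `v`, or `length p` when `v` is
-- absent.
left> : ℕ → List ℕ → ℕ
left> v [] = 0
left> v (x ∷ p) with <-cmp x v
... | tri< _ _ _ = left> v p
... | tri≈ _ _ _ = 0
... | tri> _ _ _ = suc (left> v p)

-- The swap puts the smaller `x` behind the larger `y`: `y` loses a smaller predecessor, and dually
-- `x` gains a larger one in `left>-step`.
left<-step : ∀ v → Step i p q → left< v q ≤ left< v p
left<-step v (here {x} {y} x<y) with <-cmp x v in ex | <-cmp y v in ey
... | tri< _ _ _ | tri< _ _ _ rewrite ex | ey = ≤-refl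
... | tri< _ _ _ | tri≈ _ _ _ = z≤n
... | tri< _ _ _ | tri> _ _ _ rewrite ex | ey = ≤-refl
... | tri≈ _ refl _ | tri< y<v _ _ = contradiction y<v (<-asym x<y)
... | tri≈ _ refl _ | tri≈ _ refl _ = contradiction x<y (<-irrefl refl)
... | tri≈ _ _ _ | tri> _ _ _ rewrite ex = z≤n
... | tri> _ _ v<x | tri< y<v _ _ = contradiction (<-trans x<y y<v) (<-asym v<x)
... | tri> _ _ v<x | tri≈ _ refl _ = contradiction x<y (<-asym v<x)
... | tri> _ _ _ | tri> _ _ _ rewrite ex | ey = ≤-refl
left<-step v (there {x = x} s) with <-cmp x v
... | tri< _ _ _ = s≤s (left<-step v s)
... | tri≈ _ _ _ = z≤n
... | tri> _ _ _ = left<-step v s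

left>-step : ∀ v → Step i p q → left> v p ≤ left> v q
left>-step v (here {x} {y} x<y) with <-cmp x v in ex | <-cmp y v in ey
... | tri< _ _ _ | tri< _ _ _ rewrite ex | ey = ≤-refl
... | tri< _ _ _ | tri≈ _ _ _ rewrite ey = z≤n
... | tri< _ _ _ | tri> _ _ _ rewrite ex | ey = ≤-refl
... | tri≈ _ _ _ | _ = z≤n
... | tri> _ _ v<x | tri< y<v _ _ = contradiction (<-trans x<y y<v) (<-asym v<x)
... | tri> _ _ v<x | tri≈ _ refl _ = contradiction x<y (<-asym v<x)
... | tri> _ _ _ | tri> _ _ _ rewrite ex | ey = ≤-refl
left>-step v (there {x = x} s) with <-cmp x v
... | tri< _ _ _ = left>-step v s
... | tri≈ _ _ _ = z≤n
... | tri> _ _ _ = s≤s (left>-step v s)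

-- Only the larger swapped value can lose a smaller predecessor, so at most one value per step
-- becomes small-clear.
left<-step-except : Step i p q → ∃[ y ] (∀ v → v ≡ y ⊎ left< v p ≤ left< v q)
left<-step-except (here {x} {y} {s} x<y) = y , go
  where
  go : ∀ v → v ≡ y ⊎ left< v (x ∷ y ∷ s) ≤ left< v (y ∷ x ∷ s)
  go v with <-cmp x v in ex | <-cmp y v in ey
  ... | _ | tri≈ _ y≡v _ = inj₁ (sym y≡v)
  ... | tri< _ _ _ | tri< _ _ _ rewrite ex | ey = inj₂ ≤-refl
  ... | tri< _ _ _ | tri> _ _ _ rewrite ex | ey = inj₂ ≤-refl
  ... | tri≈ _ _ _ | _ = inj₂ z≤n
  ... | tri> _ _ v<x | tri< y<v _ _ = contradiction (<-trans x<y y<v) (<-asym v<x)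
  ... | tri> _ _ _ | tri> _ _ _ rewrite ex | ey = inj₂ ≤-refl
left<-step-except (there {p = p} {q} {x = x} s) with y , f ← left<-step-except s = y , go f
  where
  go : ∀ {y} → (∀ v → v ≡ y ⊎ left< v p ≤ left< v q) →
       ∀ v → v ≡ y ⊎ left< v (x ∷ p) ≤ left< v (x ∷ q)
  go f v with <-cmp x v | f v
  ... | _          | inj₁ eq = inj₁ eq
  ... | tri< _ _ _ | inj₂ le = inj₂ (s≤s le)
  ... | tri≈ _ _ _ | inj₂ _  = inj₂ z≤n
  ... | tri> _ _ _ | inj₂ le = inj₂ le

left<-run : ∀ v → Run w p r → left< v r ≤ left< v p
left<-run v []      = ≤-refl
left<-run v (s ∷ a) = ≤-trans (left<-run v a) (left<-step v s)

left>-run : ∀ v → Run w p r → left> v p ≤ left> v r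
left>-run v []      = ≤-refl
left>-run v (s ∷ a) = ≤-trans (left>-step v s) (left>-run v a)

take⇒left : ∀ k p → v ∈ take k p → left< v p + left> v p < k
take⇒left {v} (suc k) (x ∷ p) v∈ with <-cmp x v | v∈
... | tri≈ _ _ _   | _         = s≤s z≤n
... | tri< _ x≢v _ | here refl = contradiction refl x≢v
... | tri> _ x≢v _ | here refl = contradiction refl x≢v
... | tri< _ _ _   | there v∈′ = s≤s (take⇒left k p v∈′)
... | tri> _ _ _   | there v∈′ = s≤s (subst (_≤ k) (sym (+-suc _ _)) (take⇒left k p v∈′))

-- Distinctness excludes an earlier copy of `v`, at which the counting would stop.
drop⇒left : ∀ j p → Unique p → v ∈ drop j p → j ≤ left< v p + left> v p
drop⇒left zero    p       _       _  = z≤n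
drop⇒left {v} (suc j) (x ∷ p) (x∉p ∷ u) v∈ with <-cmp x v
... | tri< _ _ _    = s≤s (drop⇒left j p u v∈)
... | tri≈ _ refl _ = contradiction refl (All.lookup (All.drop⁺ j x∉p) v∈)
... | tri> _ _ _    = subst (suc j ≤_) (sym (+-suc _ _)) (s≤s (drop⇒left j p u v∈))

card-≡ : ∀ x n → card (_≟ x) n ≤ 1
card-≡ x zero = z≤n
card-≡ x (suc n) with suc n ≟ x
... | no  _    = card-≡ x n
... | yes refl = s≤s (≤-trans (card-lower (_≟ suc n) n (λ _ e → ≤-reflexive (sym e)) n)
                              (≤-reflexive (n∸n≡0 n)))

-- Only entries at positions below `c` qualify: an absent value has count `length p`, which
-- `c ≤ length p` rules out.
card-left : ∀ c p → c ≤ length p → ∀ n → card (λ v → left< v p + left> v p <? c) n ≤ c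
card-left zero p _ n = card-upper (λ v → left< v p + left> v p <? 0) 0 (λ _ ()) n
card-left (suc c) (x ∷ p) (s≤s c≤) n = ≤-trans
  (card-⊎ (λ v → left< v (x ∷ p) + left> v (x ∷ p) <? suc c) (_≟ x)
          (λ v → left< v p + left> v p <? c) first-or-later n)
  (+-mono-≤ (card-≡ x n) (card-left c p c≤ n))
  where
  first-or-later : ∀ v → left< v (x ∷ p) + left> v (x ∷ p) < suc c →
                   v ≡ x ⊎ left< v p + left> v p < c
  first-or-later v lt with <-cmp x v
  ... | tri< _ _ _   = inj₂ (≤-pred lt)
  ... | tri≈ _ x≡v _ = inj₁ (sym x≡v)
  ... | tri> _ _ _   = inj₂ (≤-pred (subst (_< suc c) (+-suc (left< v p) _) lt))

left<-length : ∀ v p → left< v p ≤ length p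
left<-length v [] = z≤n
left<-length v (x ∷ p) with <-cmp x v
... | tri< _ _ _ = s≤s (left<-length v p)
... | tri≈ _ _ _ = z≤n
... | tri> _ _ _ = ≤-trans (left<-length v p) (n≤1+n _)

left<-∷ʳ : ∀ p → ¬ y < v → left< v (p ∷ʳ y) ≤ left< v p
left<-∷ʳ {y} {v} [] y≮v with <-cmp y v
... | tri< y<v _ _ = contradiction y<v y≮v
... | tri≈ _ _ _ = z≤n
... | tri> _ _ _ = z≤n
left<-∷ʳ {y} {v} (x ∷ p) y≮v with <-cmp x v
... | tri< _ _ _ = s≤s (left<-∷ʳ p y≮v)
... | tri≈ _ _ _ = z≤n
... | tri> _ _ _ = left<-∷ʳ p y≮v

left<-idPerm : ∀ v n → left< v (idPerm n) ≤ v ∸ 1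
left<-idPerm v zero = z≤n
left<-idPerm v (suc n) with suc n <? v
... | yes lt = ≤-trans (left<-length v (idPerm (suc n)))
                 (≤-trans (≤-reflexive (length-idPerm (suc n))) (∸-monoˡ-≤ 1 lt))
... | no  ge = ≤-trans (≤-reflexive (cong (left< v) (idPerm-suc n)))
                 (≤-trans (left<-∷ʳ (idPerm n) ge) (left<-idPerm v n))

left>-w0 : ∀ v n → left> v (w0 n) ≤ n ∸ v
left>-w0 v zero = z≤n
left>-w0 v (suc n) = ≤-trans (≤-reflexive (cong (left> v) (w0-suc n))) first
  where
  first : left> v (suc n ∷ w0 n) ≤ suc n ∸ v
  first with <-cmp (suc n) v
  ... | tri< _ _ _ = ≤-trans (left>-w0 v n) (∸-monoˡ-≤ v (n≤1+n n))
  ... | tri≈ _ _ _ = z≤n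
  ... | tri> _ _ v<n = ≤-trans (s≤s (left>-w0 v n)) (≤-reflexive (sym (+-∸-assoc 1 (≤-pred v<n))))

-- Comparing two states of a run in time

run-from : (a : Run w p r) → s ∈ states a → ∃[ w′ ] Run w′ s r
run-from []      (here refl) = _ , []
run-from (s ∷ a) (here refl) = _ , s ∷ a
run-from (_ ∷ a) (there s∈)  = run-from a s∈

run-to : (a : Run w p r) → s ∈ states a → ∃[ w′ ] Run w′ p s
run-to []      (here refl) = _ , []
run-to (_ ∷ _) (here refl) = _ , []
run-to (s ∷ a) (there s∈) with _ , b ← run-to a s∈ = _ , s ∷ b

states-ordered : ∀ {t} (a : Run w p r) → s ∈ states a → t ∈ states a →
                 (∃[ w′ ] Run w′ s t) ⊎ (∃[ w′ ] Run w′ t s)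
states-ordered a@[]      s∈ (here refl) = inj₂ (run-to a s∈)
states-ordered a@(_ ∷ _) s∈ (here refl) = inj₂ (run-to a s∈)
states-ordered a@(_ ∷ _) (here refl) t∈@(there _) = inj₁ (run-to a t∈)
states-ordered (_ ∷ a) (there s∈) (there t∈) = states-ordered a s∈ t∈

-- Splitting a run in time

run-length : Run w p r → length r ≡ length p
run-length []      = refl
run-length (s ∷ a) = trans (run-length a) (step-length s)

-- A discrete intermediate value argument: cut at the first state where `φ` reaches `m`. An empty
-- `u` covers a start already at or above `m`, an empty `v` a run that never gets there.
split-run : (φ : List ℕ → ℕ) → (∀ {i p q} → Step i p q → φ q ≤ suc (φ p)) →
  ∀ m → Run w p r → ∃[ u ] ∃[ v ] ∃[ c ] w ≡ u ++ v × Run u p c × Run v c r ×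
    (φ c ≤ m ⊎ u ≡ []) × (m ≤ φ c ⊎ v ≡ [])
split-run φ grow m [] = [] , [] , _ , refl , [] , [] , inj₂ refl , inj₂ refl
split-run {p = p} φ grow m (_∷_ {q = q} s a) with m ≤? φ p
... | yes m≤φ = [] , _ , p , refl , [] , s ∷ a , inj₂ refl , inj₁ m≤φ
... | no  m≰φ with split-run φ grow m a
...   | [] , v , _ , refl , [] , b , _ , late =
  -- `φ` was below `m` before this step, so it is at most `m` after it.
  _ , v , q , refl , s ∷ [] , b , inj₁ (≤-trans (grow s) (≰⇒> m≰φ)) , late
...   | u@(_ ∷ _) , v , c , refl , b , b′ , inj₁ early , late =
  _ , v , c , refl , s ∷ b , b′ , inj₁ early , late

card-left<-grows : ∀ k n → Step i p q →
  card (λ v → left< v q <? k) n ≤ suc (card (λ v → left< v p <? k) n)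
card-left<-grows {p = p} {q} k n s with y , f ← left<-step-except s = ≤-trans
  (card-⊎ (λ v → left< v q <? k) (_≟ y) (λ v → left< v p <? k) split n)
  (+-monoˡ-≤ _ (card-≡ y n))
  where
  split : ∀ v → left< v q < k → v ≡ y ⊎ left< v p < k
  split v lt with f v
  ... | inj₁ eq = inj₁ eq
  ... | inj₂ le = inj₂ (≤-<-trans le lt)

-- With `c` the state at the cut, `u` keeps the small-clear values of `c` and `v` the large-clear
-- ones. Both restrict the entire run, since only then is the result a sorting word; the letters
-- from the other half are discarded from the count.
sorting-split : k + k ≤ m + n → Sorting (m + n) w →
  ∃[ a ] ∃[ b ] ∃[ u ] ∃[ v ] a ≤ m × b ≤ n + (k + k) ×
    Sorting a u × Sorting b v × occ k w ≤ occ k u + occ k v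
sorting-split {k} {m} {n} {w} 2k≤N run
  with u , v , c , refl , a , b , early , late ← split-run
         (λ p → card (λ v → left< v p <? k) (m + n)) (card-left<-grows k (m + n)) m run =
  let α , u′ , α≤m , U , le₁ = before early
      β , v′ , β≤  , V , le₂ = after late
  in α , β , u′ , v′ , α≤m , β≤ , U , V ,
     ≤-trans (≤-reflexive (occ-++ k u v)) (+-mono-≤ le₁ le₂)
  where
  N = m + n
  L? : Decidable (λ x → left< x c < k)
  L? x = left< x c <? k
  R? : Decidable (λ x → left> x c < k)
  R? x = left> x c <? k
  before : card L? N ≤ m ⊎ u ≡ [] → ∃[ α ] ∃[ u′ ] α ≤ m × Sorting α u′ × occ k u ≤ occ k u′
  -- An empty half has no letters to preserve, so the empty word on no values serves.
  before (inj₂ refl) = 0 , [] , z≤n , [] , z≤n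
  -- Smaller predecessors only disappear on the way to `c`, so fewer than `k` of them at an earlier
  -- state leaves fewer than `k` at `c`.
  before (inj₁ le)
    with w₁ , a′ , count ← restrict-top L? k a (All.tabulate λ s∈ → All.tabulate λ {x} x∈ →
           ≤-<-trans (left<-run x (proj₂ (run-from a s∈)))
             (≤-<-trans (m≤m+n _ _) (take⇒left k _ x∈)))
       | w₂ , b′ ← restrict L? b =
    _ , _ , le , standardize L? N (a′ ▷ b′) ,
    ≤-trans count (≤-trans (m≤m+n _ _) (≤-reflexive (sym (occ-++ k w₁ w₂))))
  -- A value clear on both sides has position below `k + k`; this overlap is the excess in the size
  -- of `v`.
  total : card L? N + card R? N ≤ N + (k + k)
  total = ≤-trans
    (card-∩ L? R? (λ x → left< x c + left> x c <? k + k) (λ _ → +-mono-<) N)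
    (+-monoʳ-≤ N (card-left (k + k) c
      (subst (k + k ≤_) (sym (trans (run-length a) (length-idPerm N))) 2k≤N) N))
  after : m ≤ card L? N ⊎ v ≡ [] →
    ∃[ β ] ∃[ v′ ] β ≤ n + (k + k) × Sorting β v′ × occ k v ≤ occ k v′
  after (inj₂ refl) = 0 , [] , z≤n , [] , z≤n
  after (inj₁ ge)
    with w₁ , a′ ← restrict R? a
       | w₂ , b′ , count ← restrict-top R? k b (All.tabulate λ s∈ → All.tabulate λ {x} x∈ →
           ≤-<-trans (left>-run x (proj₂ (run-to b s∈)))
             (≤-<-trans (m≤n+m _ _) (take⇒left k _ x∈))) =
    _ , _ , +-cancelˡ-≤ m _ _ (≤-trans (+-monoˡ-≤ _ ge) (≤-trans total (≤-reflexive (+-assoc m n _)))) ,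
    standardize R? N (a′ ▷ b′) ,
    ≤-trans count (≤-trans (m≤n+m _ _) (≤-reflexive (sym (occ-++ k w₁ w₂))))

-- Time reversal

step-prefix : ∀ s → Step i p q → Step (length s + i) (s ++ p) (s ++ q)
step-prefix []      a = a
step-prefix (_ ∷ s) a = there (step-prefix s a)

-- Reversing the lists turns the ascent into a descent; exchanging source and target makes it an
-- ascent again.
step-reverse : Step i p q → Step (length p ∸ suc (suc i)) (reverse q) (reverse p)
step-reverse (here {x} {y} {s} x<y) = subst₂ (Step (length s)) (reverse₂ y x) (reverse₂ x y)
  (subst (λ l → Step l (reverse s ++ x ∷ y ∷ []) (reverse s ++ y ∷ x ∷ []))
    (trans (+-identityʳ _) (length-reverse s)) (step-prefix (reverse s) (here x<y)))
  where
  reverse₂ : ∀ x y → reverse s ++ y ∷ x ∷ [] ≡ reverse (x ∷ y ∷ s)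
  reverse₂ x y = sym (trans (unfold-reverse x (y ∷ s))
    (trans (cong (_∷ʳ x) (unfold-reverse y s)) (++-assoc (reverse s) _ _)))
step-reverse (there {p = p} {q} {x} s) =
  subst₂ (Step _) (sym (unfold-reverse x q)) (sym (unfold-reverse x p)) (step-++ _ (step-reverse s))

run-reverse : ∀ k → Run w p r →
  ∃[ w′ ] Run w′ (reverse r) (reverse p) × occ (length p ∸ k) w ≤ occ k w′
run-reverse k [] = [] , [] , z≤n
run-reverse {p = p} k (_∷_ {i} {w = w} s a) with w′ , b , le ← run-reverse k a =
  w′ ++ letter ∷ [] , b ▷ (step-reverse s ∷ []) , count
  where
  -- The reflected letter `length p ∸ suc i`, written as a successor to fit `Run`.
  letter = suc (length p ∸ suc (suc i))
  le′ : occ (length p ∸ k) w ≤ occ k w′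
  le′ = subst (λ l → occ (l ∸ k) w ≤ occ k w′) (step-length s) le
  letter≡k : suc i ≡ length p ∸ k → letter ≡ k
  letter≡k eq = trans (sym (+-∸-assoc 1 (step-bound s))) (complement (length p) k eq)
  count : occ (length p ∸ k) (suc i ∷ w) ≤ occ k (w′ ++ letter ∷ [])
  count with suc i ≟ length p ∸ k
  ... | yes eq = begin
    occ (length p ∸ k) (suc i ∷ w)  ≡⟨ occ-accept _ w eq ⟩
    suc (occ (length p ∸ k) w)      ≤⟨ s≤s le′ ⟩
    suc (occ k w′)                  ≡⟨ +-comm 1 _ ⟩
    occ k w′ + 1                    ≡⟨ cong (occ k w′ +_) (occ-accept k [] (letter≡k eq)) ⟨
    occ k w′ + occ k (letter ∷ [])  ≡⟨ occ-++ k w′ _ ⟨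
    occ k (w′ ++ letter ∷ [])       ∎
    where open ≤-Reasoning
  ... | no neq = begin
    occ (length p ∸ k) (suc i ∷ w)  ≡⟨ occ-reject _ w neq ⟩
    occ (length p ∸ k) w            ≤⟨ le′ ⟩
    occ k w′                        ≤⟨ m≤m+n _ _ ⟩
    occ k w′ + occ k (letter ∷ [])  ≡⟨ occ-++ k w′ _ ⟨
    occ k (w′ ++ letter ∷ [])       ∎
    where open ≤-Reasoning

-- The reversal of `w0 n` is the identity, so reversing a sorting run gives a sorting run.
sorting-reverse : ∀ k → Sorting n w → ∃[ w′ ] Sorting n w′ × occ (n ∸ k) w ≤ occ k w′
sorting-reverse {n} {w} k a with w′ , b , le ← run-reverse k a =
  w′ , subst (λ l → Run w′ l (w0 n)) (reverse-involutive (idPerm n)) b ,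
  subst (λ l → occ (l ∸ k) w ≤ occ k w′) (length-idPerm n) le

-- Separating the top positions from the bottom ones

idPerm-unique : ∀ n → Unique (idPerm n)
idPerm-unique n = Unique.map⁺ suc-injective (Unique.upTo⁺ n)

sorting-top-bottom : Sorting n w →
  ∃[ a ] ∃[ b ] ∃[ u ] ∃[ v ] a + b ≤ n + (k + k + (k + k)) ×
    Sorting a u × Sorting b v × occ k w + occ (n ∸ k) w ≤ occ k u + occ k v
sorting-top-bottom {n} {w} {k} run =
  let u , U , le₁ = restrict-top Top? k run (All.tabulate λ s∈ → All.tabulate λ x∈ → lose s∈ x∈)
      v , V , le₂ = restrict-bottom Bottom? k run
        (subst (λ l → All (λ s → All Bottom (drop (l ∸ k) s)) (states run)) (sym (length-idPerm n))
          (All.tabulate λ s∈ → All.tabulate λ x∈ → bottom s∈ x∈))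
      v′ , V′ , le₃ = sorting-reverse k (standardize Bottom? n V)
  in card Top? n , card Bottom? n , u , v′ , sizes , standardize Top? n U , V′ ,
     +-mono-≤ le₁ (≤-trans
       (subst₂ (λ a b → occ (a ∸ k) w ≤ occ (b ∸ k) v) (length-idPerm n) (card-length Bottom? n) le₂)
       le₃)
  where
  Top Extreme Bottom : ℕ → Set
  Top x = Any (λ s → x ∈ take k s) (states run)
  Extreme x = x ≤ k + k ⊎ n ∸ (k + k) < x
  -- Chosen so that `Top` and `Bottom` meet inside `Extreme` by definition; the work is to show that
  -- every value visiting the last `k` positions belongs to it.
  Bottom x = ¬ Top x ⊎ Extreme x
  Top? : Decidable Top
  Top? x = any? (λ s → x ∈? take k s) (states run)
  Extreme? : Decidable Extreme
  Extreme? x = (x ≤? k + k) ⊎-dec (n ∸ (k + k) <? x)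
  Bottom? : Decidable Bottom
  Bottom? x = ¬? (Top? x) ⊎-dec Extreme? x
  sizes : card Top? n + card Bottom? n ≤ n + (k + k + (k + k))
  -- Each of the two ranges in `Extreme` contributes at most `k + k`.
  sizes = ≤-trans (card-∩ Top? Bottom? Extreme? both n) (+-monoʳ-≤ n (≤-trans
    (card-⊎ Extreme? (_≤? k + k) (n ∸ (k + k) <?_) (λ _ → id) n)
    (+-mono-≤ (card-upper (_≤? k + k) (k + k) (λ _ → id) n)
      (≤-trans (card-lower (n ∸ (k + k) <?_) (n ∸ (k + k)) (λ _ → id) n)
        (m≤n+o⇒m∸n≤o n (n ∸ (k + k)) (≤-trans (m≤n+m∸n n (k + k)) (≤-reflexive (+-comm (k + k) _))))))))
    where
    both : ∀ x → Top x → Bottom x → Extreme x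
    both x top (inj₁ ¬top) = contradiction top ¬top
    both x top (inj₂ e)    = e
  crowded : ∀ {s x} → s ∈ states run → x ∈ drop (n ∸ k) s → n ≤ k + (left< x s + left> x s)
  crowded {s} s∈ bot = ≤-trans (m≤n+m∸n n k) (+-monoʳ-≤ k (drop⇒left (n ∸ k) s
    (All.lookup (states-invariant step-unique run (idPerm-unique n)) s∈) bot))
  -- If x goes from the top to the bottom, at most k smaller values precede it from then on
  -- and at most k follow it at the end, so x ≤ 2k; the other order bounds the larger values.
  extreme : ∀ {s t x} → s ∈ states run → x ∈ drop (n ∸ k) s → t ∈ states run → x ∈ take k t → Extreme x
  extreme {s} {t} {x} s∈ bot t∈ top with states-ordered run s∈ t∈
  ... | inj₂ (_ , t→s) with x ≤? n
  ...   | no  x≰n = inj₂ (≤-<-trans (m∸n≤m n (k + k)) (≰⇒> x≰n))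
  ...   | yes x≤n = inj₁ (+-cancelʳ-≤ (n ∸ x) _ _ (begin
    x + (n ∸ x)                          ≡⟨ m+[n∸m]≡n x≤n ⟩
    n                                    ≤⟨ crowded s∈ bot ⟩
    k + (left< x s + left> x s)          ≤⟨ +-monoʳ-≤ k (+-mono-≤
      (≤-trans (left<-run x t→s) (<⇒≤ (≤-<-trans (m≤m+n _ _) (take⇒left k t top))))
      (≤-trans (left>-run x (proj₂ (run-from run s∈))) (left>-w0 x n))) ⟩
    k + (k + (n ∸ x))                    ≡⟨ +-assoc k k _ ⟨
    k + k + (n ∸ x)                      ∎))
    where open ≤-Reasoning
  extreme {x = zero} _ _ _ _ | inj₁ _ = inj₁ z≤n
  extreme {s} {t} {x@(suc x′)} s∈ bot t∈ top | inj₁ (_ , s→t) = inj₂ (s≤s (m≤n+o⇒m∸n≤o n (k + k) (begin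
    n                            ≤⟨ crowded s∈ bot ⟩
    k + (left< x s + left> x s)  ≤⟨ +-monoʳ-≤ k (+-mono-≤
      (≤-trans (left<-run x (proj₂ (run-to run s∈))) (left<-idPerm x n))
      (≤-trans (left>-run x s→t) (<⇒≤ (≤-<-trans (m≤n+m _ _) (take⇒left k t top))))) ⟩
    k + (x′ + k)                 ≡⟨ cong (k +_) (+-comm x′ k) ⟩
    k + (k + x′)                 ≡⟨ +-assoc k k x′ ⟨
    k + k + x′                   ∎)))
    where open ≤-Reasoning
  bottom : ∀ {s x} → s ∈ states run → x ∈ drop (n ∸ k) s → Bottom x
  bottom {x = x} s∈ bot with Top? x
  ... | no  ¬top = inj₁ ¬top
  ... | yes top with _ , t∈ , x∈ ← find top = inj₂ (extreme s∈ bot t∈ x∈)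

-- Almost additive sequences

module AlmostAdditive (f : ℕ → ℕ) (k d : ℕ)
  (super : ∀ m n → k < m → k < n → f m + f n ≤ f (m + n))
  (sub   : ∀ m n → k < m → k < n → f (m + n) ≤ f m + f (n + d))
  (shift : ∀ n → k < n → f n ≤ f (n + d)) where

  multiple-lower : ∀ r n → k < n → suc r * f n ≤ f (suc r * n)
  multiple-lower zero n k<n = ≤-reflexive (trans (+-identityʳ _) (cong f (sym (+-identityʳ n))))
  multiple-lower (suc r) n k<n = ≤-trans (+-monoʳ-≤ (f n) (multiple-lower r n k<n))
    (super n (suc r * n) k<n (≤-trans k<n (m≤m+n n _)))

  -- Each copy of `n` split off by `sub` becomes `n + d`; `shift` brings the last copy to the same
  -- form.
  multiple-upper : ∀ r n → k < n → f (suc r * n) ≤ suc r * f (n + d)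
  multiple-upper zero n k<n = begin
    f (n + 0)         ≡⟨ cong f (+-identityʳ n) ⟩
    f n               ≤⟨ shift n k<n ⟩
    f (n + d)         ≡⟨ +-identityʳ _ ⟨
    f (n + d) + 0     ∎
    where open ≤-Reasoning
  multiple-upper (suc r) n k<n = begin
    f (n + suc r * n)             ≡⟨ cong f (+-comm n _) ⟩
    f (suc r * n + n)             ≤⟨ sub (suc r * n) n (≤-trans k<n (m≤m+n n _)) k<n ⟩
    f (suc r * n) + f (n + d)     ≤⟨ +-monoˡ-≤ _ (multiple-upper r n k<n) ⟩
    suc r * f (n + d) + f (n + d) ≡⟨ +-comm _ (f (n + d)) ⟩
    suc (suc r) * f (n + d)       ∎
    where open ≤-Reasoning

  -- Compare two estimates of `f (r * n)`: from below as `r` copies of `n`, from above as `n` copies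
  -- of `r`.
  cross-bound : ∀ r n → k < r → k < n → r * f n ≤ n * f (r + d)
  cross-bound r@(suc r′) n@(suc n′) k<r k<n = begin
    r * f n        ≤⟨ multiple-lower r′ n k<n ⟩
    f (r * n)      ≡⟨ cong f (*-comm r n) ⟩
    f (n * r)      ≤⟨ multiple-upper n′ r k<r ⟩
    n * f (r + d)  ∎
    where open ≤-Reasoning

  -- A crude linear growth rate: `cross-bound` at the least admissible `r`, namely `suc k`.
  slope : ℕ
  slope = f (suc k + d)

  linear : ∀ n → k < n → f n ≤ n * slope
  linear n k<n = ≤-trans (m≤m+n (f n) _) (cross-bound (suc k) n ≤-refl k<n)

  -- `cross-bound` at `m ∸ d` has `f m` on its right side; the missing `d` copies of `f n` are paid
  -- for by `linear`.
  almost-proportional : ∀ m n → k + d < m → k < n → m * f n ≤ n * f m + d * slope * n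
  almost-proportional m n k+d<m k<n = begin
    m * f n                       ≡⟨ cong (_* f n) m′+d≡m ⟨
    (m′ + d) * f n                 ≡⟨ *-distribʳ-+ (f n) m′ d ⟩
    m′ * f n + d * f n             ≤⟨ +-mono-≤ (cross-bound m′ n (m+n≤o⇒m≤o∸n (suc k) k+d<m) k<n)
                                              (*-monoʳ-≤ d (linear n k<n)) ⟩
    n * f (m′ + d) + d * (n * slope) ≡⟨ cong₂ _+_ (cong (λ l → n * f l) m′+d≡m)
                                        (trans (cong (d *_) (*-comm n slope)) (sym (*-assoc d slope n))) ⟩
    n * f m + d * slope * n       ∎
    where
    open ≤-Reasoning
    m′ = m ∸ d
    m′+d≡m : m′ + d ≡ m
    m′+d≡m = m∸n+n≡m (≤-trans (m≤n+m d k) (<⇒≤ k+d<m))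

  increment : ℕ → ℕ
  increment e = e * slope + d * slope + d * slope * e

  -- Divide `almost-proportional` for `n` and `n + e` by `n`. The three terms of `increment` come
  -- from `e * f n`, `C * n` and `C * e`.
  bounded-increment : ∀ e n → k + d < n → f (n + e) ≤ f n + increment e
  bounded-increment e n@(suc _) k+d<n = *-cancelˡ-≤ n (begin
    n * f (n + e)                                       ≤⟨ almost-proportional n (n + e) k+d<n
                                                             (≤-trans k<n (m≤m+n n e)) ⟩
    (n + e) * f n + C * (n + e)                         ≡⟨ expand n (f n) e C ⟩
    n * f n + (e * f n + C * n) + C * e                 ≤⟨ +-mono-≤ (+-monoʳ-≤ (n * f n)
                                                             (+-monoˡ-≤ (C * n) (*-monoʳ-≤ e (linear n k<n))))
                                                             (m≤n*m (C * e) n) ⟩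
    n * f n + (e * (n * slope) + C * n) + n * (C * e)   ≡⟨ collect n (f n) e slope C ⟩
    n * (f n + increment e)                             ∎)
    where
    open ≤-Reasoning
    C = d * slope
    k<n : k < n
    k<n = ≤-trans (s≤s (m≤m+n k d)) k+d<n
    expand : ∀ n x e c → (n + e) * x + c * (n + e) ≡ n * x + (e * x + c * n) + c * e
    expand = solve-∀
    collect : ∀ n x e s c → n * x + (e * (n * s) + c * n) + n * (c * e) ≡ n * (x + (e * s + c + c * e))
    collect = solve-∀

-- Rational estimates

-- The hypothesis is the conclusion cleared of denominators, which are the successors of `n`, `q`
-- and `m`.
frac-<-+ : ∀ a b m n p q .(c : Coprime (suc p) (suc q)) →
           a * (suc q * suc m) < (suc p * suc m + b * suc q) * suc n →
           frac a (suc n) ℚ.< mkℚ ℤ.+[1+ p ] q c ℚ.+ frac b (suc m)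
frac-<-+ a b m n p q c lt = ℚ.toℚᵘ-cancel-<
  (ℚᵘ.<-respˡ-≃ (ℚᵘ.≃-sym (ℚ.toℚᵘ-fromℚᵘ (mkℚᵘ (ℤ.+ a) n)))
    (ℚᵘ.<-respʳ-≃ (ℚᵘ.≃-sym (ℚᵘ.≃-trans (ℚ.toℚᵘ-homo-+ ε (frac b (suc m)))
                     (ℚᵘ.+-congʳ (toℚᵘ ε) (ℚ.toℚᵘ-fromℚᵘ (mkℚᵘ (ℤ.+ b) m)))))
      (*<* (subst₂ ℤ._<_ (ℤ.pos-* a _) num (ℤ.+<+ lt)))))
  where
  ε = mkℚ ℤ.+[1+ p ] q c
  num : ℤ.+ ((suc p * suc m + b * suc q) * suc n)
        ≡ (ℤ.+ suc p ℤ.* ℤ.+ suc m ℤ.+ ℤ.+ b ℤ.* ℤ.+ suc q) ℤ.* ℤ.+ suc n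
  num = trans (ℤ.pos-* (suc p * suc m + b * suc q) (suc n))
    (cong (ℤ._* ℤ.+ suc n) (trans (ℤ.pos-+ (suc p * suc m) (b * suc q)) (cong₂ ℤ._+_ (ℤ.pos-* (suc p) (suc m)) (ℤ.pos-* b (suc q)))))

<-+⇒-< : ∀ {x y z : ℚ} → x ℚ.< z ℚ.+ y → x ℚ.- y ℚ.< z
<-+⇒-< {x} {y} {z} lt = subst (x ℚ.- y ℚ.<_)
  (trans (ℚ.+-assoc z y (ℚ.- y)) (trans (cong (z ℚ.+_) (ℚ.+-inverseʳ y)) (ℚ.+-identityʳ z)))
  (ℚ.+-monoˡ-< (ℚ.- y) lt)

∣-∣-< : ∀ {x y z : ℚ} → x ℚ.< z ℚ.+ y → y ℚ.< z ℚ.+ x → ℚ.∣ x ℚ.- y ∣ ℚ.< z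
∣-∣-< {x} {y} {z} lt gt with ℚ.∣p∣≡p∨∣p∣≡-p (x ℚ.- y)
... | inj₁ eq = subst (ℚ._< z) (sym eq) (<-+⇒-< {x} {y} lt)
... | inj₂ eq = subst (ℚ._< z) (sym (trans eq negate)) (<-+⇒-< {y} {x} gt)
  where
  negate : ℚ.- (x ℚ.- y) ≡ y ℚ.- x
  negate = Group.⁻¹-anti-homo-// ℚ.+-0-group x y

-- The two hypotheses are the estimate `|a/m - b/n| ≤ C (1/m + 1/n)` multiplied by `m * n`.
frac-close : ∀ C (ε : ℚ) → 0ℚ ℚ.< ε → ∃[ N ] (∀ a b m n → N ≤ m → N ≤ n →
  a * n ≤ b * m + C * (m + n) → b * m ≤ a * n + C * (m + n) →
  ℚ.∣ frac a m ℚ.- frac b n ∣ ℚ.< ε)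
frac-close C ε 0<ε with ε | ℚ.positive 0<ε
... | mkℚ ℤ.+[1+ p ] q c | _ = suc K , close
  where
  -- As `ε` is at least `1/(q+1)`, denominators beyond `K` make `C/m` and `C/n` each smaller than
  -- `ε/2`.
  K = 2 * (C * suc q)
  bound : ∀ a b m n → K < suc m → K < suc n → a * suc n ≤ b * suc m + C * (suc m + suc n) →
          a * (suc q * suc n) < (suc p * suc n + b * suc q) * suc m
  bound a b m n K<m K<n le = begin-strict
    a * (D * N)                            ≡⟨ rearrange a D N ⟩
    D * (a * N)                            ≤⟨ *-monoʳ-≤ D le ⟩
    D * (b * M + C * (M + N))              ≡⟨ *-distribˡ-+ D (b * M) _ ⟩
    D * (b * M) + D * (C * (M + N))        <⟨ +-monoʳ-< (D * (b * M)) small ⟩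
    D * (b * M) + N * M                    ≤⟨ +-monoʳ-≤ (D * (b * M)) (*-monoˡ-≤ M (m≤n*m N (suc p))) ⟩
    D * (b * M) + suc p * N * M            ≡⟨ collect D b M (suc p) N ⟩
    (suc p * N + b * D) * M                ∎
    where
    open ≤-Reasoning
    M = suc m
    N = suc n
    D = suc q
    rearrange : ∀ a q n → a * (q * n) ≡ q * (a * n)
    rearrange = solve-∀
    collect : ∀ q b m p n → q * (b * m) + p * n * m ≡ (p * n + b * q) * m
    collect = solve-∀
    double : ∀ q c m n → 2 * (q * (c * (m + n))) ≡ 2 * (c * q) * m + 2 * (c * q) * n
    double = solve-∀
    twice : ∀ m n → n * m + m * n ≡ 2 * (n * m)
    twice = solve-∀
    -- Doubled, the left side is `K * M + K * N`, and each summand is below one copy of `N * M`.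
    small : D * (C * (M + N)) < N * M
    small = *-cancelˡ-< 2 _ _ (begin-strict
      2 * (D * (C * (M + N)))  ≡⟨ double D C M N ⟩
      K * M + K * N            <⟨ +-mono-< (*-monoˡ-< M K<n) (*-monoˡ-< N K<m) ⟩
      N * M + M * N            ≡⟨ twice M N ⟩
      2 * (N * M)              ∎)
  close : ∀ a b m n → suc K ≤ m → suc K ≤ n →
    a * n ≤ b * m + C * (m + n) → b * m ≤ a * n + C * (m + n) →
    ℚ.∣ frac a m ℚ.- frac b n ∣ ℚ.< mkℚ ℤ.+[1+ p ] q c
  -- The bound `suc K` excludes zero denominators, hence the default value of `frac`.
  close a b (suc m) (suc n) K<m K<n le ge = ∣-∣-<
    (frac-<-+ a b n m p q c (bound a b m n K<m K<n le))
    (frac-<-+ b a m n p q c (bound b a n m K<n K<m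
      (subst (λ l → b * suc m ≤ a * suc n + C * l) (+-comm (suc m) (suc n)) ge)))

-- The one-sided hypothesis holds for all pairs, so exchanging `m` and `n` supplies the opposite
-- inequality.
cauchy : ∀ (f : ℕ → ℕ) C N₀ →
  (∀ m n → N₀ ≤ m → N₀ ≤ n → m * f n ≤ n * f m + C * (m + n)) → CauchyQ (λ n → frac (f n) n)
cauchy f C N₀ near ε 0<ε with N , close ← frac-close C ε 0<ε =
  N₀ ⊔ N , λ m n ≤m ≤n →
    close (f m) (f n) m n (≤-trans (m≤n⊔m N₀ N) ≤m) (≤-trans (m≤n⊔m N₀ N) ≤n)
      (subst₂ _≤_ (*-comm n (f m)) (cong₂ _+_ (*-comm m (f n)) (cong (C *_) (+-comm n m)))
        (near n m (≤-trans (m≤m⊔n N₀ N) ≤n) (≤-trans (m≤m⊔n N₀ N) ≤m)))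
      (subst₂ _≤_ (*-comm m (f n)) (cong (_+ C * (m + n)) (*-comm n (f m)))
        (near m n (≤-trans (m≤m⊔n N₀ N) ≤m) (≤-trans (m≤m⊔n N₀ N) ≤n)))

diff-to-zero : ∀ (f g : ℕ → ℕ) C N₀ → (∀ n → N₀ ≤ n → g n ≤ f n × f n ≤ g n + C) →
  DiffToZero (λ n → frac (f n) n) (λ n → frac (g n) n)
diff-to-zero f g C N₀ near ε 0<ε with N , close ← frac-close C ε 0<ε =
  N₀ ⊔ N , λ n ≤n →
    let g≤f , f≤g+C = near n (≤-trans (m≤m⊔n N₀ N) ≤n)
        N≤n = ≤-trans (m≤n⊔m N₀ N) ≤n
    in close (f n) (g n) n n N≤n N≤n
      (begin
        f n * n                   ≤⟨ *-monoˡ-≤ n f≤g+C ⟩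
        (g n + C) * n             ≡⟨ *-distribʳ-+ n (g n) C ⟩
        g n * n + C * n           ≤⟨ +-monoʳ-≤ (g n * n) (*-monoʳ-≤ C (m≤m+n n n)) ⟩
        g n * n + C * (n + n)     ∎)
      (≤-trans (*-monoˡ-≤ n g≤f) (m≤m+n _ _))
  where open ≤-Reasoning

-- The two maxima

module _ (P? : Decidable P) (Q? : Decidable Q) where

  length-filter-mono : (∀ {i} → P i → Q i) → ∀ w → length (filter P? w) ≤ length (filter Q? w)
  length-filter-mono imp [] = z≤n
  length-filter-mono imp (i ∷ w) with P? i | Q? i
  ... | no  _ | no  _ = length-filter-mono imp w
  ... | no  _ | yes _ = ≤-trans (length-filter-mono imp w) (n≤1+n _)
  ... | yes _ | yes _ = s≤s (length-filter-mono imp w)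
  ... | yes p | no ¬q = contradiction (imp p) ¬q

  -- Only an inequality: a letter satisfying both conditions counts twice on the right, as happens
  -- when `n` is `2 * k`.
  length-filter-⊎ : ∀ w → length (filter (λ i → P? i ⊎-dec Q? i) w) ≤
                          length (filter P? w) + length (filter Q? w)
  length-filter-⊎ [] = z≤n
  length-filter-⊎ (i ∷ w) with P? i | Q? i
  ... | no  _ | no  _ = length-filter-⊎ w
  ... | no  _ | yes _ = ≤-trans (s≤s (length-filter-⊎ w)) (≤-reflexive (sym (+-suc _ _)))
  ... | yes _ | no  _ = s≤s (length-filter-⊎ w)
  ... | yes _ | yes _ = s≤s (≤-trans (length-filter-⊎ w) (+-monoʳ-≤ _ (n≤1+n _)))

module Maxima (k : ℕ) (M Mbar : ℕ → ℕ)
  (isMax    : ∀ n → k < n → IsMaxOverReduced n (occ k) (M n))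
  (isMaxBar : ∀ n → k < n → IsMaxOverReduced n (occBar k n) (Mbar n)) where

  d e : ℕ
  d = k + k
  e = d + d

  occ≤M : m ≤ n → k < n → Sorting m w → occ k w ≤ M n
  occ≤M m≤n k<n a with w , b , le ← extend m≤n a =
    ≤-trans (le k) (proj₂ (isMax _ k<n) w (sorting⇒reduced b))

  super : ∀ m n → k < m → k < n → M m + M n ≤ M (m + n)
  super m n k<m k<n
    with u , reduced-u , u≡ ← proj₁ (isMax m k<m)
       | v , reduced-v , v≡ ← proj₁ (isMax n k<n)
    with w , a , le ← join (reduced⇒sorting reduced-u) (reduced⇒sorting reduced-v) =
    subst (_≤ M (m + n)) (cong₂ _+_ u≡ v≡)
      (≤-trans (le k) (occ≤M ≤-refl (≤-trans k<m (m≤m+n m n)) a))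

  sub : ∀ m n → k < m → k < n → M (m + n) ≤ M m + M (n + d)
  sub m n k<m k<n
    with w , reduced , w≡ ← proj₁ (isMax (m + n) (≤-trans k<m (m≤m+n m n)))
    with _ , _ , _ , _ , a≤m , b≤n+d , U , V , le ←
           sorting-split {k} {m} {n} (+-mono-≤ (<⇒≤ k<m) (<⇒≤ k<n)) (reduced⇒sorting reduced) =
    subst (_≤ M m + M (n + d)) w≡ (≤-trans le
      (+-mono-≤ (occ≤M a≤m k<m U) (occ≤M b≤n+d (≤-trans k<n (m≤m+n n d)) V)))

  shift : ∀ n → k < n → M n ≤ M (n + d)
  shift n k<n with w , reduced , w≡ ← proj₁ (isMax n k<n) =
    subst (_≤ M (n + d)) w≡
      (occ≤M (m≤m+n n d) (≤-trans k<n (m≤m+n n d)) (reduced⇒sorting reduced))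

  M≤Mbar : ∀ n → k < n → M n ≤ Mbar n
  M≤Mbar n k<n with w , reduced , w≡ ← proj₁ (isMax n k<n) =
    subst (_≤ Mbar n) w≡ (≤-trans
      (length-filter-mono (_≟ k) (λ i → (i ≟ k) ⊎-dec (i ≟ n ∸ k)) inj₁ w)
      (proj₂ (isMaxBar n k<n) w reduced))

  -- After reversal both kinds of letters are counted as `s_k`, so the top and bottom words join
  -- into one word on at most `n + e` values.
  Mbar≤M : ∀ n → k < n → Mbar n ≤ M (n + e)
  Mbar≤M n k<n
    with w , reduced , w≡ ← proj₁ (isMaxBar n k<n)
    with _ , _ , _ , _ , size , U , V , le ← sorting-top-bottom {k = k} (reduced⇒sorting reduced)
    with _ , a , le′ ← join U V =
    subst (_≤ M (n + e)) w≡ (≤-trans (length-filter-⊎ (_≟ k) (_≟ n ∸ k) w)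
      (≤-trans le (≤-trans (le′ k) (occ≤M size (≤-trans k<n (m≤m+n n e)) a))))

  open AlmostAdditive M k d super sub shift

  N₀ C E : ℕ
  N₀ = suc (k + d)
  C  = d * slope
  E  = increment e

  k<N₀ : N₀ ≤ n → k < n
  k<N₀ = ≤-trans (s≤s (m≤m+n k d))

  M-Mbar : ∀ n → N₀ ≤ n → M n ≤ Mbar n × Mbar n ≤ M n + E
  M-Mbar n N₀≤n = M≤Mbar n (k<N₀ N₀≤n) ,
    ≤-trans (Mbar≤M n (k<N₀ N₀≤n)) (bounded-increment e n N₀≤n)

  M-near : ∀ m n → N₀ ≤ m → N₀ ≤ n → m * M n ≤ n * M m + C * (m + n)
  M-near m n N₀≤m N₀≤n = ≤-trans (almost-proportional m n N₀≤m (k<N₀ N₀≤n))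
    (+-monoʳ-≤ (n * M m) (*-monoʳ-≤ C (m≤n+m n m)))

  -- Pass to `M` and back: replacing `Mbar n` by `M n` costs `E`, while returning from `M m` to
  -- `Mbar m` is free.
  Mbar-near : ∀ m n → N₀ ≤ m → N₀ ≤ n → m * Mbar n ≤ n * Mbar m + (C + E) * (m + n)
  Mbar-near m n N₀≤m N₀≤n = begin
    m * Mbar n                              ≤⟨ *-monoʳ-≤ m (proj₂ (M-Mbar n N₀≤n)) ⟩
    m * (M n + E)                           ≡⟨ *-distribˡ-+ m (M n) E ⟩
    m * M n + m * E                         ≤⟨ +-mono-≤ (M-near m n N₀≤m N₀≤n) (*-monoˡ-≤ E (m≤m+n m n)) ⟩
    n * M m + C * (m + n) + (m + n) * E     ≤⟨ +-monoˡ-≤ _ (+-monoˡ-≤ _ (*-monoʳ-≤ n (proj₁ (M-Mbar m N₀≤m)))) ⟩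
    n * Mbar m + C * (m + n) + (m + n) * E  ≡⟨ collect (n * Mbar m) C E (m + n) ⟩
    n * Mbar m + (C + E) * (m + n)          ∎
    where
    open ≤-Reasoning
    collect : ∀ a c e s → a + c * s + s * e ≡ a + (c + e) * s
    collect = solve-∀

theorem4p3 : (M Mbar : ℕ → ℕ → ℕ) →
    (∀ k n → 1 ≤ k → k < n → IsMaxOverReduced n (occ k) (M k n)) →
    (∀ k n → 1 ≤ k → k < n → IsMaxOverReduced n (occBar k n) (Mbar k n)) →
    ∀ k → 1 ≤ k →
    CauchyQ (λ n → frac (M k n) n) ×
    CauchyQ (λ n → frac (Mbar k n) n) ×
    DiffToZero (λ n → frac (Mbar k n) n) (λ n → frac (M k n) n)
theorem4p3 M Mbar isMax isMaxBar k 1≤k =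
  cauchy (M k) C N₀ M-near , cauchy (Mbar k) (C + E) N₀ Mbar-near ,
  diff-to-zero (Mbar k) (M k) E N₀ M-Mbar
  where
  open Maxima k (M k) (Mbar k) (λ n → isMax k n 1≤k) (λ n → isMaxBar k n 1≤k)
    using (C; E; N₀; M-near; Mbar-near; M-Mbar)
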